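{- Let $G$ be a maximal $K_4$-minor free graph of order $n\geq 3$. Then $\gamma_{\times 2}(G)\leq \lfloor \frac{2n}{3}\rfloor$. -}

module Defs where

open import Data.Nat using (ℕ; _≤_)
open import Data.Fin using (Fin)
open import Data.Fin.Properties using (_≟_)
open import Data.Fin.Subset using (Subset; _∈_; _∩_; _∪_; ⁅_⁆; ∣_∣; Nonempty; Empty)
open import Data.Product using (Σ-syntax; ∃-syntax; _×_; _,_; swap)
open import Data.Sum as Sum using (_⊎_; inj₁; inj₂)
open import Data.Vec using (tabulate)
open import Function using (_∘_)
open import Level using (0ℓ)
open import Relation.Binary using (Rel; Decidable; Symmetric; Irreflexive)
open import Relation.Binary.Construct.Closure.ReflexiveTransitive using (Star)
open import Relation.Binary.PropositionalEquality using (_≡_; _≢_; sym; trans; ≢-sym)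
open import Relation.Nullary using (¬_; does)
open import Relation.Nullary.Decidable using (_×-dec_; _⊎-dec_; ¬?)

-- Finite simple graphs of order n, with vertex set Fin n.
record Graph (n : ℕ) : Set₁ where
  field
    Adj    : Rel (Fin n) 0ℓ
    adj?   : Decidable Adj
    symm   : Symmetric Adj
    irrefl : Irreflexive _≡_ Adj

open Graph public

K : ∀ m → Graph m
K m = record
  { Adj    = _≢_
  ; adj?   = λ i j → ¬? (i ≟ j)
  ; symm   = ≢-sym
  ; irrefl = λ i≡j i≢j → i≢j i≡j
  }

addEdge : ∀ {n} (G : Graph n) (u v : Fin n) → u ≢ v → Graph n
addEdge {n} G u v u≢v = record
  { Adj    = λ x y → Adj G x y ⊎ New x y
  ; adj?   = λ x y → adj? G x y ⊎-dec (((x ≟ u) ×-dec (y ≟ v)) ⊎-dec ((x ≟ v) ×-dec (y ≟ u)))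
  ; symm   = Sum.map (symm G) (Sum.swap ∘ Sum.map swap swap)
  ; irrefl = λ { x≡y (inj₁ e)                  → irrefl G x≡y e
               ; x≡y (inj₂ (inj₁ (x≡u , y≡v))) → u≢v (trans (sym x≡u) (trans x≡y y≡v))
               ; x≡y (inj₂ (inj₂ (x≡v , y≡u))) → u≢v (trans (sym y≡u) (trans (sym x≡y) x≡v))
               }
  }
  where
  New : Rel (Fin n) 0ℓ
  New x y = (x ≡ u × y ≡ v) ⊎ (x ≡ v × y ≡ u)

-- B induces a connected subgraph of G; in particular B is nonempty.
ConnectedIn : ∀ {n} → Graph n → Subset n → Set
ConnectedIn G B =
  Nonempty B ×
  (∀ {x y} → x ∈ B → y ∈ B → Star (λ u v → u ∈ B × v ∈ B × Adj G u v) x y)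

-- H is a minor of G: contracting the disjoint connected branch sets
-- (and deleting the remaining vertices and superfluous edges) yields H.
record _IsMinorOf_ {m n} (H : Graph m) (G : Graph n) : Set where
  field
    branch    : Fin m → Subset n
    connected : ∀ i → ConnectedIn G (branch i)
    disjoint  : ∀ {i j} → i ≢ j → Empty (branch i ∩ branch j)
    joined    : ∀ {i j} → Adj H i j →
                ∃[ x ] ∃[ y ] x ∈ branch i × y ∈ branch j × Adj G x y

K₄MinorFree : ∀ {n} → Graph n → Set
K₄MinorFree G = ¬ (K 4 IsMinorOf G)

MaximalK₄MinorFree : ∀ {n} → Graph n → Set
MaximalK₄MinorFree G =
  K₄MinorFree G ×
  (∀ u v (u≢v : u ≢ v) → ¬ Adj G u v → ¬ K₄MinorFree (addEdge G u v u≢v))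

N[_,_] : ∀ {n} → Graph n → Fin n → Subset n
N[ G , v ] = ⁅ v ⁆ ∪ tabulate (λ u → does (adj? G v u))

DoubleDominating : ∀ {n} → Graph n → Subset n → Set
DoubleDominating G S = ∀ v → 2 ≤ ∣ N[ G , v ] ∩ S ∣

-- γ×2(G) = k.  A relation rather than a function, because a graph with an
-- isolated vertex has no double dominating set at all.
γ×2[_]≡_ : ∀ {n} → Graph n → ℕ → Set
γ×2[_]≡_ {n} G k =
  (Σ[ S ∈ Subset n ] DoubleDominating G S × ∣ S ∣ ≡ k) ×
  (∀ (S : Subset n) → DoubleDominating G S → k ≤ ∣ S ∣)

{-# OPTIONS --safe #-}

-- Everything is proved up to double negation, which is harmless because the
-- existence of a small double dominating set is decidable.
--
-- (1) A nonempty graph of minimum degree ≥ 3 has a K₄ minor.  Contracting an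
-- edge uv keeps the minimum degree ≥ 3 unless u and v have a common neighbour
-- of degree 3, or u and v are twins: N[u] = N[v] = {u,v,a,b}.  The first
-- obstruction, met at two successive edges, produces twins; and twins either
-- lie in a K₄ or can be contracted together into a, unless a or b has degree 3,
-- in which case the third edge at that vertex lies in no triangle.
--
-- (2) A vertex of degree ≤ 2 whose neighbours form a clique can be deleted
-- without destroying a K₄ minor.  So a vertex v of degree ≤ 2 in a maximal
-- K₄-minor-free graph has two adjacent neighbours, and G - v is again maximal.
-- By induction G has a proper 3-colouring and every vertex is in a triangle.
--
-- (3) Each triangle meets every colour, so the union of any two colour classes
-- is double dominating, and the two smallest have at most 2n/3 vertices.
module Submission where

open import Data.Bool using (if_then_else_)
open import Data.Empty using (⊥; ⊥-elim)
open import Data.Fin using (Fin; zero; suc; punchIn)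
import Data.Fin.Properties as Fin
open import Data.Fin.Subset as Subset using (Subset; _∩_; ∣_∣)
import Data.Fin.Subset.Properties as Subset
open import Data.List using (List; length; filter; allFin)
open import Data.List.Membership.Propositional using (_∈_; lose)
open import Data.List.Membership.Propositional.Properties using (∈-filter⁺; ∈-filter⁻; ∈-allFin)
open import Data.List.Properties using (filter-notAll)
open import Data.Maybe using (Maybe; just; nothing)
import Data.Maybe.Properties as Maybe
open import Data.Nat as ℕ using (ℕ; _≤_; _<_; _+_; _*_; _/_; z≤n; s≤s)
import Data.Nat.DivMod as ℕ
import Data.Nat.Properties as ℕ
open import Data.Nat.Induction using (<-wellFounded)
open import Data.Nat.Solver using (module +-*-Solver)
open import Data.Product using (∃; ∃-syntax; _×_; _,_; proj₁; proj₂)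
open import Data.Sum as Sum using (_⊎_; inj₁; inj₂; [_,_]′)
open import Data.Vec using (tabulate)
open import Data.Vec.Properties using (lookup⇒[]=; []=⇒lookup; lookup∘tabulate)
open import Function using (_∘_)
open import Induction.WellFounded using (Acc; acc)
open import Level using (0ℓ)
open import Relation.Binary using (Rel; Symmetric; DecidableEquality)
open import Relation.Binary.Construct.Closure.ReflexiveTransitive as Star using (Star; ε; _◅_; _◅◅_)
open import Relation.Binary.PropositionalEquality using (_≡_; _≢_; refl; sym; trans; cong; subst; ≢-sym)
open import Relation.Nullary using (¬_; yes; no; does)
open import Relation.Nullary.Decidable using (¬?; _⊎-dec_; _×-dec_; dec-true; dec-false; decidable-stable)
open import Relation.Unary using (Pred; Decidable)
open import Defs

-- Adjacency is not assumed decidable, so distinctions on it are made only while proving `⊥`.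
cases : {P : Set} → (P → ⊥) → (¬ P → ⊥) → ⊥
cases f g = g f

-- K₄ minors as partial labellings, and contraction.

module Minors {V : Set} (_≟_ : DecidableEquality V) where

  Within : Rel V 0ℓ → Pred V 0ℓ → Rel V 0ℓ
  Within E P u v = P u × P v × E u v

  -- A K₄ minor: branch set i consists of the vertices labelled just i.
  record Minor (E : Rel V 0ℓ) : Set where
    field
      label : V → Maybe (Fin 4)
      conn  : ∀ {i x y} → label x ≡ just i → label y ≡ just i →
              Star (Within E (λ t → label t ≡ just i)) x y
      join  : ∀ {i j} → i ≢ j →
              ∃[ x ] ∃[ y ] label x ≡ just i × label y ≡ just j × E x y

  minor-mono : ∀ {E F : Rel V 0ℓ} → (∀ {x y} → E x y → F x y) → Minor E → Minor F
  minor-mono E⊆F m = record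
    { label = label
    ; conn  = λ p q → Star.map (λ (a , b , e) → a , b , E⊆F e) (conn p q)
    ; join  = λ i≢j → let x , y , p , q , e = join i≢j in x , y , p , q , E⊆F e
    }
    where open Minor m

  clique-minor : ∀ {E : Rel V 0ℓ} → (∀ {x} → ¬ E x x) → (f : Fin 4 → V) →
                 (∀ {i j} → i ≢ j → E (f i) (f j)) → Minor E
  clique-minor {E} irr f adj = record
    { label = label
    ; conn  = λ p q → subst (Star _ _) (trans (sym (label⁻ p)) (label⁻ q)) ε
    ; join  = λ {i} {j} i≢j → f i , f j , label⁺ i , label⁺ j , adj i≢j
    }
    where
    label : V → Maybe (Fin 4)
    label t with Fin.any? (λ i → f i ≟ t)
    ... | yes (i , _) = just i
    ... | no _        = nothing

    label⁻ : ∀ {t i} → label t ≡ just i → f i ≡ t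
    label⁻ {t} eq with Fin.any? (λ i → f i ≟ t)
    label⁻ refl | yes (_ , fi≡t) = fi≡t

    label⁺ : ∀ i → label (f i) ≡ just i
    label⁺ i with Fin.any? (λ j → f j ≟ f i)
    ... | no ∄ = ⊥-elim (∄ (i , refl))
    -- The index found must be `i`: if `f j ≡ f i` with `j ≢ i`, the edge between them would be a
    -- loop.
    ... | yes (j , fj≡fi) with j Fin.≟ i
    ...   | yes refl = refl
    ...   | no j≢i   = ⊥-elim (irr (subst (E _) fj≡fi (adj (≢-sym j≢i))))

  -- The contraction of the fibres of `φ`, without loops. It lives on the same type `V`, a fibre
  -- being represented by its image, so repeated contraction needs no quotient types.
  _/φ_ : Rel V 0ℓ → (V → V) → Rel V 0ℓ
  (E /φ φ) s t = s ≢ t × ∃[ s′ ] ∃[ t′ ] φ s′ ≡ s × φ t′ ≡ t × E s′ t′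

  -- Every fibre is a star around its fixed point, hence connected. A path in the contraction
  -- therefore lifts: consecutive lifted edges meet in a common fibre and are linked through its
  -- centre.
  minor-pullback : ∀ {E : Rel V 0ℓ} (φ : V → V) → Symmetric E →
                   (∀ t → φ (φ t) ≡ φ t) → (∀ t → φ t ≡ t ⊎ E t (φ t)) →
                   Minor (E /φ φ) → Minor E
  minor-pullback {E} φ E-sym idem near m = record
    { label = label ∘ φ
    ; conn  = λ p q → lift refl refl p q (conn p q)
    ; join  = λ i≢j → joined (join i≢j)
    }
    where
    open Minor m
    Class : Fin 4 → Pred V 0ℓ
    Class i t = label (φ t) ≡ just i

    to-centre : ∀ {i} x → Class i x → Star (Within E (Class i)) x (φ x)
    to-centre {i} x p with near x
    ... | inj₁ eq = subst (Star _ x) (sym eq) ε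
    ... | inj₂ e  = (p , trans (cong label (idem x)) p , e) ◅ ε

    from-centre : ∀ {i} x → Class i x → Star (Within E (Class i)) (φ x) x
    from-centre {i} x p = Star.reverse {T = Within E (Class i)} (λ (a , b , e) → b , a , E-sym e) (to-centre x p)

    fibre : ∀ {i x y} → φ x ≡ φ y → Class i x → Class i y → Star (Within E (Class i)) x y
    fibre {x = x} {y} eq p q = to-centre x p ◅◅ subst (λ z → Star (Within E (Class _)) z y) (sym eq) (from-centre y q)

    lift : ∀ {i x y s t} → φ x ≡ s → φ y ≡ t → Class i x → Class i y →
           Star (Within (E /φ φ) (λ t → label t ≡ just i)) s t → Star (Within E (Class i)) x y
    lift ex ey p q ε = fibre (trans ex (sym ey)) p q
    lift ex ey p q ((_ , r , _ , s′ , t′ , es , et , e) ◅ path) =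
      fibre (trans ex (sym es)) p p′ ◅◅ ((p′ , q′ , e) ◅ lift et ey q′ q path)
      where
      p′ = trans (cong label (trans es (sym ex))) p
      q′ = trans (cong label et) r

    joined : ∀ {i j} → ∃[ x ] ∃[ y ] label x ≡ just i × label y ≡ just j × (E /φ φ) x y →
             ∃[ x ] ∃[ y ] Class i x × Class j y × E x y
    joined (x , y , p , q , _ , s′ , t′ , es , et , e) =
      s′ , t′ , trans (cong label es) p , trans (cong label et) q , e

  collapse : {D : Pred V 0ℓ} → Decidable D → V → V → V
  collapse D? y t = if does (D? t) then y else t

  module Collapse {D : Pred V 0ℓ} (D? : Decidable D) (y : V) where
    φ : V → V
    φ = collapse D? y

    inside : ∀ {t} → D t → φ t ≡ y
    inside {t} d rewrite dec-true (D? t) d = refl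

    outside : ∀ {t} → ¬ D t → φ t ≡ t
    outside {t} ¬d rewrite dec-false (D? t) ¬d = refl

    idem : ¬ D y → ∀ t → φ (φ t) ≡ φ t
    idem ¬Dy t with D? t
    ... | yes _ = outside ¬Dy
    ... | no ¬d = outside ¬d

    near : ∀ (E : Rel V 0ℓ) → (∀ t → D t → E t y) → ∀ t → φ t ≡ t ⊎ E t (φ t)
    near E adj t with D? t
    ... | yes d = inj₂ (adj t d)
    ... | no _  = inj₁ refl

  -- Graphs on a list of live vertices, and degree conditions.

  record IsGraph (E : Rel V 0ℓ) (A : List V) : Set where
    field
      E-sym : Symmetric E
      irr   : ∀ {x} → ¬ E x x
      -- Vertices outside `A` are isolated: deletion and contraction keep `V` and shorten `A`, whose
      -- length is the induction measure.
      live  : ∀ {x y} → E x y → x ∈ A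

    adj⇒≢ : ∀ {x y} → E x y → x ≢ y
    adj⇒≢ e refl = irr e

    live′ : ∀ {x y} → E x y → y ∈ A
    live′ = live ∘ E-sym

  record Three (P : Pred V 0ℓ) : Set where
    constructor three
    field
      {a b c} : V
      a≢b : a ≢ b
      a≢c : a ≢ c
      b≢c : b ≢ c
      Pa : P a
      Pb : P b
      Pc : P c

  -- The case `u ≡ v` is allowed and expresses two elements besides a single vertex, as in
  -- `two-others`.
  record TwoBesides (u v : V) (P : Pred V 0ℓ) : Set where
    constructor two
    field
      {a b} : V
      a≢b : a ≢ b
      Pa : P a
      Pb : P b
      a≢u : a ≢ u
      b≢u : b ≢ u
      a≢v : a ≢ v
      b≢v : b ≢ v

  two-others : ∀ {P} → Three P → ∀ u → TwoBesides u u P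
  two-others (three {a} {b} {c} ab ac bc Pa Pb Pc) u with a ≟ u | b ≟ u
  ... | yes refl | _        = two bc Pb Pc (≢-sym ab) (≢-sym ac) (≢-sym ab) (≢-sym ac)
  ... | no a≢    | yes refl = two ac Pa Pc a≢ (≢-sym bc) a≢ (≢-sym bc)
  ... | no a≢    | no b≢    = two ab Pa Pb a≢ b≢ a≢ b≢

  one-other : ∀ {P} → Three P → ∀ u v → ∃[ z ] P z × z ≢ u × z ≢ v
  one-other d u v with two-others d u
  ... | two {a} {b} a≢b Pa Pb a≢u b≢u _ _ with a ≟ v
  ...   | yes refl = b , Pb , b≢u , ≢-sym a≢b
  ...   | no a≢v   = a , Pa , a≢u , a≢v

  record Twins (E : Rel V 0ℓ) (u v a b : V) : Set where
    field
      a≢b : a ≢ b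
      uv : E u v
      ua : E u a
      ub : E u b
      va : E v a
      vb : E v b
      N-u : ∀ t → E u t → t ≡ v ⊎ t ≡ a ⊎ t ≡ b
      N-v : ∀ t → E v t → t ≡ u ⊎ t ≡ a ⊎ t ≡ b

  swap-twins : ∀ {E u v a b} → Twins E u v a b → Twins E u v b a
  swap-twins T = record
    { a≢b = ≢-sym a≢b ; uv = uv ; ua = ub ; ub = ua ; va = vb ; vb = va
    ; N-u = λ t e → Sum.map₂ Sum.swap (N-u t e) ; N-v = λ t e → Sum.map₂ Sum.swap (N-v t e) }
    where open Twins T

  -- Three vertices that will be neighbours of u after contracting uv.
  record Merged (E : Rel V 0ℓ) (u v : V) : Set where
    constructor merged
    field
      {a b c} : V
      a≢b : a ≢ b
      a≢c : a ≢ c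
      b≢c : b ≢ c
      ea : E u a ⊎ E v a
      eb : E u b ⊎ E v b
      ec : E u c ⊎ E v c
      outside : ∀ {t} → t ≡ a ⊎ t ≡ b ⊎ t ≡ c → t ≢ u × t ≢ v

  record Dense (E : Rel V 0ℓ) (A : List V) : Set where
    field
      graph : IsGraph E A
      dense : ∀ {x} → x ∈ A → ¬ ¬ Three (E x)
      some  : ∃[ x ] x ∈ A

  -- Minimum degree three forces a K₄ minor.

  module Reduce {E : Rel V 0ℓ} {A : List V} (D : Dense E A) (free : ¬ Minor E)
                (ih : ∀ {E′ A′} → length A′ < length A → Dense E′ A′ → ¬ ¬ Minor E′) where
    open Dense D
    open IsGraph graph

    -- All of `D` is merged into its common neighbour `y`. If the degrees survive, the smaller graph
    -- has a minor by induction, and it pulls back to `E`, against `free`.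
    contract : {D : Pred V 0ℓ} (D? : Decidable D) (y : V) → ¬ D y → (∀ t → D t → E t y) →
               ∃ D → (∀ {t} → t ∈ A → ¬ D t → ¬ ¬ Three ((E /φ collapse D? y) t)) → ⊥
    contract {D} D? y ¬Dy adj (d , Dd) degrees =
      ih smaller dense′ (free ∘ minor-pullback φ E-sym (idem ¬Dy) (near E adj))
      where
      open Collapse D? y
      A′ = filter (¬? ∘ D?) A

      smaller : length A′ < length A
      smaller = filter-notAll (¬? ∘ D?) A (lose (live (adj d Dd)) (λ ¬Dd → ¬Dd Dd))

      y∈A′ : y ∈ A′
      y∈A′ = ∈-filter⁺ (¬? ∘ D?) (live′ (adj d Dd)) ¬Dy

      φ∈A′ : ∀ {t} → t ∈ A → φ t ∈ A′
      φ∈A′ {t} t∈A with D? t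
      ... | yes _ = y∈A′
      ... | no ¬d = ∈-filter⁺ (¬? ∘ D?) t∈A ¬d

      dense′ : Dense (E /φ φ) A′
      dense′ = record
        { graph = record
          { E-sym = λ (s≢t , s′ , t′ , p , q , e) → ≢-sym s≢t , t′ , s′ , q , p , E-sym e
          ; irr   = λ (s≢s , _) → s≢s refl
          ; live  = λ (_ , _ , _ , p , _ , e) → subst (_∈ A′) p (φ∈A′ (live e))
          }
        ; dense = λ x∈A′ → let x∈A , ¬Dx = ∈-filter⁻ (¬? ∘ D?) x∈A′ in degrees x∈A ¬Dx
        ; some  = y , y∈A′
        }

    -- Merging `v` into `u` costs another vertex a neighbour only if it was adjacent to both;
    -- `common` then supplies two neighbours besides the merged one. The merged vertex itself is
    -- served by `Merged`.
    contract-edge : ∀ {u v} → E u v → (∀ w → E w u → E w v → ¬ ¬ TwoBesides u v (E w)) →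
                    Merged E u v → ⊥
    contract-edge {u} {v} uv common (merged {a} {b} {c} a≢b a≢c b≢c ea eb ec out) =
      contract (_≟ v) u (adj⇒≢ uv) (λ { _ refl → E-sym uv }) (v , refl) degrees
      where
      open Collapse (_≟ v) u

      u-adj : ∀ {t} → t ≢ u × t ≢ v → E u t ⊎ E v t → (E /φ φ) u t
      u-adj (t≢u , t≢v) (inj₁ e) = ≢-sym t≢u , _ , _ , outside (adj⇒≢ uv) , outside t≢v , e
      u-adj (t≢u , t≢v) (inj₂ e) = ≢-sym t≢u , _ , _ , inside refl , outside t≢v , e

      keep : ∀ {s t} → s ≢ v → t ≢ v → E s t → (E /φ φ) s t
      keep s≢v t≢v e = adj⇒≢ e , _ , _ , outside s≢v , outside t≢v , e

      degrees : ∀ {t} → t ∈ A → t ≢ v → ¬ ¬ Three ((E /φ φ) t)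
      degrees {t} t∈A t≢v k with t ≟ u
      ... | yes refl = k (three a≢b a≢c b≢c (u-adj (out (inj₁ refl)) ea)
                           (u-adj (out (inj₂ (inj₁ refl))) eb) (u-adj (out (inj₂ (inj₂ refl))) ec))
      ... | no t≢u = cases
        (λ (tv : E t v) → others tv λ { (two p≢q tp tq p≢u q≢u p≢v q≢v) →
          k (three (≢-sym p≢u) (≢-sym q≢u) p≢q (t≢u , _ , _ , outside t≢v , inside refl , tv)
              (keep t≢v p≢v tp) (keep t≢v q≢v tq)) })
        (λ ¬tv → dense t∈A λ { (three pq pr qr tp tq tr) →
          k (three pq pr qr (keep t≢v (λ { refl → ¬tv tp }) tp)
              (keep t≢v (λ { refl → ¬tv tq }) tq) (keep t≢v (λ { refl → ¬tv tr }) tr)) })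
        where
        others : E t v → ¬ ¬ TwoBesides u v (E t)
        others tv k = cases (λ tu → common t tu tv k)
          (λ ¬tu → dense t∈A λ d → let two p≢q tp tq p≢v q≢v _ _ = two-others d v in
            k (two p≢q tp tq (λ { refl → ¬tu tp }) (λ { refl → ¬tu tq }) p≢v q≢v))

    -- Let `a`, `b` be neighbours of `u` other than `v`. Any further neighbour of `u` or `v`
    -- completes a `Merged`. Otherwise the two neighbours `c`, `d` of `v` besides `u` are distinct
    -- members of `{a, b}`, which makes `u` and `v` twins.
    merged-or-twins : ∀ {u v} → E u v → (Merged E u v → ⊥) → (∀ {a b} → Twins E u v a b → ⊥) → ⊥
    merged-or-twins {u} {v} uv ¬merged ¬twins =
      dense (live uv) λ du → dense (live′ uv) λ dv → go (two-others du v) (two-others dv u)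
      where
      go : TwoBesides v v (E u) → TwoBesides u u (E v) → ⊥
      go (two {a} {b} a≢b ua ub a≢v b≢v _ _) (two {c} {d} c≢d vc vd c≢u d≢u _ _) = ¬twins twins
        where
        within : ∀ t → E u t ⊎ E v t → t ≢ u → t ≢ v → t ≡ a ⊎ t ≡ b
        within t e t≢u t≢v with t ≟ a | t ≟ b
        ... | yes p | _     = inj₁ p
        ... | no _  | yes p = inj₂ p
        ... | no ¬p | no ¬q = ⊥-elim (¬merged (merged a≢b (≢-sym ¬p) (≢-sym ¬q) (inj₁ ua) (inj₁ ub) e
          λ { (inj₁ refl)        → ≢-sym (adj⇒≢ ua) , a≢v
            ; (inj₂ (inj₁ refl)) → ≢-sym (adj⇒≢ ub) , b≢v
            ; (inj₂ (inj₂ refl)) → t≢u , t≢v }))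

        common : E v a × E v b
        common with within c (inj₂ vc) c≢u (≢-sym (adj⇒≢ vc)) | within d (inj₂ vd) d≢u (≢-sym (adj⇒≢ vd))
        ... | inj₁ refl | inj₁ refl = ⊥-elim (c≢d refl)
        ... | inj₁ refl | inj₂ refl = vc , vd
        ... | inj₂ refl | inj₁ refl = vd , vc
        ... | inj₂ refl | inj₂ refl = ⊥-elim (c≢d refl)

        N-u : ∀ t → E u t → t ≡ v ⊎ t ≡ a ⊎ t ≡ b
        N-u t e with t ≟ v
        ... | yes p  = inj₁ p
        ... | no t≢v = inj₂ (within t (inj₁ e) (≢-sym (adj⇒≢ e)) t≢v)

        N-v : ∀ t → E v t → t ≡ u ⊎ t ≡ a ⊎ t ≡ b
        N-v t e with t ≟ u
        ... | yes p  = inj₁ p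
        ... | no t≢u = inj₂ (within t (inj₂ e) t≢u (≢-sym (adj⇒≢ e)))

        twins : Twins E u v a b
        twins = record { a≢b = a≢b ; uv = uv ; ua = ua ; ub = ub
                       ; va = proj₁ common ; vb = proj₂ common ; N-u = N-u ; N-v = N-v }

    -- Otherwise `a` has exactly one neighbour `z` besides `u` and `v`. Neither twin is adjacent to
    -- `z`, so `az` lies in no triangle and can be contracted; the merged vertex keeps `u`, `v` and
    -- another neighbour `c` of `z`.
    twins-extra : ∀ {u v a b} → Twins E u v a b → ¬ E a b → ¬ ¬ TwoBesides u v (E a)
    twins-extra {u} {v} {a} {b} T ¬ab ¬two =
      dense (live′ ua) λ da → go (one-other da u v)
      where
      open Twins T
      go : ∃[ z ] E a z × z ≢ u × z ≢ v → ⊥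
      go (z , az , z≢u , z≢v) =
        dense (live′ az) λ dz → merge (one-other dz a a)
        where
        ¬uz : ¬ E u z
        ¬uz uz with N-u z uz
        ... | inj₁ z≡v         = z≢v z≡v
        ... | inj₂ (inj₁ refl) = irr az
        ... | inj₂ (inj₂ refl) = ¬ab az

        ¬vz : ¬ E v z
        ¬vz vz with N-v z vz
        ... | inj₁ z≡u         = z≢u z≡u
        ... | inj₂ (inj₁ refl) = irr az
        ... | inj₂ (inj₂ refl) = ¬ab az

        no-common : ∀ w → E w a → E w z → ¬ ¬ TwoBesides a z (E w)
        no-common w wa wz _ with w ≟ u | w ≟ v
        ... | yes refl | _        = ¬uz wz
        ... | no _     | yes refl = ¬vz wz
        ... | no w≢u   | no w≢v   = ¬two (two (adj⇒≢ wz) (E-sym wa) az w≢u z≢u w≢v z≢v)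

        merge : ∃[ c ] E z c × c ≢ a × c ≢ a → ⊥
        merge (c , zc , c≢a , _) = contract-edge az no-common
          (merged (adj⇒≢ uv) (λ { refl → ¬uz (E-sym zc) }) (λ { refl → ¬vz (E-sym zc) })
            (inj₁ (E-sym ua)) (inj₁ (E-sym va)) (inj₂ zc)
            λ { (inj₁ refl)        → adj⇒≢ ua , ≢-sym z≢u
              ; (inj₂ (inj₁ refl)) → adj⇒≢ va , ≢-sym z≢v
              ; (inj₂ (inj₂ refl)) → c≢a , ≢-sym (adj⇒≢ zc) })

    twins-clique : ∀ {u v a b} → Twins E u v a b → E a b → Minor E
    twins-clique {u} {v} {a} {b} T ab = clique-minor irr f adj
      where
      open Twins T
      f : Fin 4 → V
      f zero                   = u
      f (suc zero)             = v
      f (suc (suc zero))       = a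
      f (suc (suc (suc zero))) = b

      adj : ∀ {i j} → i ≢ j → E (f i) (f j)
      adj {zero} {zero} i≢j = ⊥-elim (i≢j refl)
      adj {zero} {suc zero} _ = uv
      adj {zero} {suc (suc zero)} _ = ua
      adj {zero} {suc (suc (suc zero))} _ = ub
      adj {suc zero} {zero} _ = E-sym uv
      adj {suc zero} {suc zero} i≢j = ⊥-elim (i≢j refl)
      adj {suc zero} {suc (suc zero)} _ = va
      adj {suc zero} {suc (suc (suc zero))} _ = vb
      adj {suc (suc zero)} {zero} _ = E-sym ua
      adj {suc (suc zero)} {suc zero} _ = E-sym va
      adj {suc (suc zero)} {suc (suc zero)} i≢j = ⊥-elim (i≢j refl)
      adj {suc (suc zero)} {suc (suc (suc zero))} _ = ab
      adj {suc (suc (suc zero))} {zero} _ = E-sym ub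
      adj {suc (suc (suc zero))} {suc zero} _ = E-sym vb
      adj {suc (suc (suc zero))} {suc (suc zero)} _ = E-sym ab
      adj {suc (suc (suc zero))} {suc (suc (suc zero))} i≢j = ⊥-elim (i≢j refl)

    -- If `ab` is an edge, the four vertices form a K₄. Otherwise both twins are contracted into
    -- `a`: this creates the edge `ab`, and `twins-extra` gives `a` and `b` two further neighbours
    -- each.
    no-twins : ∀ {u v a b} → Twins E u v a b → ⊥
    no-twins {u} {v} {a} {b} T = cases (free ∘ twins-clique T) λ ¬ab →
      twins-extra T ¬ab λ ra → twins-extra (swap-twins T) (¬ab ∘ E-sym) λ rb → collapse-twins ¬ab ra rb
      where
      open Twins T
      collapse-twins : ¬ E a b → TwoBesides u v (E a) → TwoBesides u v (E b) → ⊥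
      collapse-twins ¬ab ra rb =
        contract D? a a∉D (λ { _ (inj₁ refl) → ua ; _ (inj₂ refl) → va }) (u , inj₁ refl) degrees
        where
        D? : Decidable (λ t → t ≡ u ⊎ t ≡ v)
        D? t = (t ≟ u) ⊎-dec (t ≟ v)
        open Collapse D? a

        a∉D : ¬ (a ≡ u ⊎ a ≡ v)
        a∉D = [ ≢-sym (adj⇒≢ ua) , ≢-sym (adj⇒≢ va) ]′

        b∉D : ¬ (b ≡ u ⊎ b ≡ v)
        b∉D = [ ≢-sym (adj⇒≢ ub) , ≢-sym (adj⇒≢ vb) ]′

        keep : ∀ {s t} → ¬ (s ≡ u ⊎ s ≡ v) → ¬ (t ≡ u ⊎ t ≡ v) → E s t → (E /φ φ) s t
        keep s∉D t∉D e = adj⇒≢ e , _ , _ , outside s∉D , outside t∉D , e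

        degrees : ∀ {t} → t ∈ A → ¬ (t ≡ u ⊎ t ≡ v) → ¬ ¬ Three ((E /φ φ) t)
        degrees {t} t∈A t∉D k with t ≟ a | t ≟ b
        ... | yes refl | _ = let two p≢q ap aq p≢u q≢u p≢v q≢v = ra in
          k (three (λ { refl → ¬ab ap }) (λ { refl → ¬ab aq }) p≢q
              (a≢b , u , b , inside (inj₁ refl) , outside b∉D , ub)
              (keep a∉D [ p≢u , p≢v ]′ ap) (keep a∉D [ q≢u , q≢v ]′ aq))
        ... | no _ | yes refl = let two p≢q bp bq p≢u q≢u p≢v q≢v = rb in
          k (three (λ { refl → ¬ab (E-sym bp) }) (λ { refl → ¬ab (E-sym bq) }) p≢q
              (≢-sym a≢b , b , u , outside b∉D , inside (inj₁ refl) , E-sym ub)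
              (keep b∉D [ p≢u , p≢v ]′ bp) (keep b∉D [ q≢u , q≢v ]′ bq))
        ... | no t≢a | no t≢b = dense t∈A λ { (three pq pr qr tp tq tr) →
          k (three pq pr qr (keep t∉D (far tp) tp) (keep t∉D (far tq) tq) (keep t∉D (far tr) tr)) }
          where
          -- Outside the pair, only `a` and `b` are adjacent to a twin, so every other vertex keeps
          -- all its edges.
          far : ∀ {s} → E t s → ¬ (s ≡ u ⊎ s ≡ v)
          far ts (inj₁ refl) with N-u t (E-sym ts)
          ... | inj₁ t≡v        = t∉D (inj₂ t≡v)
          ... | inj₂ (inj₁ t≡a) = t≢a t≡a
          ... | inj₂ (inj₂ t≡b) = t≢b t≡b
          far ts (inj₂ refl) with N-v t (E-sym ts)
          ... | inj₁ t≡u        = t∉D (inj₁ t≡u)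
          ... | inj₂ (inj₁ t≡a) = t≢a t≡a
          ... | inj₂ (inj₂ t≡b) = t≢b t≡b

    -- Read contrapositively: the ends of every edge have, up to double negation, a common neighbour
    -- with at most one further neighbour.
    unblocked : ∀ {u v} → E u v → (∀ w → E w u → E w v → ¬ ¬ TwoBesides u v (E w)) → ⊥
    unblocked uv common = merged-or-twins uv (contract-edge uv common) no-twins

    ¬two⇒N : ∀ {x p q z} → ¬ TwoBesides p q (E x) → E x z → z ≢ p → z ≢ q →
              ∀ t → E x t → t ≡ p ⊎ t ≡ q ⊎ t ≡ z
    ¬two⇒N {x} {p} {q} {z} ¬two xz z≢p z≢q t xt with t ≟ p | t ≟ q | t ≟ z
    ... | yes e  | _      | _      = inj₁ e
    ... | no _   | yes e  | _      = inj₂ (inj₁ e)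
    ... | no _   | no _   | yes e  = inj₂ (inj₂ e)
    ... | no t≢p | no t≢q | no t≢z = ⊥-elim (¬two (two t≢z xt xz t≢p z≢p t≢q z≢q))

    -- Here `w` has neighbours `u`, `v`, `z`, and `u` has neighbours `w`, `v`, `z`, so `w` and `u`
    -- are twins over `v`, `z`.
    blocked-twice : ∀ {u v w z} → E u v → E w u → E w v → E w z → z ≢ v → E u z →
                    (∀ t → E w t → t ≡ u ⊎ t ≡ v ⊎ t ≡ z) → ¬ TwoBesides w z (E u) → ⊥
    blocked-twice {u} {v} {w} {z} uv wu wv wz z≢v uz N-w ¬two = no-twins {w} {u} {v} {z} record
      { a≢b = ≢-sym z≢v ; uv = wu ; ua = wv ; ub = wz ; va = uv ; vb = uz ; N-u = N-w
      ; N-v = λ t ut → Sum.map₂ Sum.swap (¬two⇒N ¬two uv (≢-sym (adj⇒≢ wv)) (≢-sym z≢v) t ut) }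

    contradiction : ⊥
    contradiction = dense (proj₂ some) λ d → edge (Three.Pa d)
      where
      edge : ∀ {u v} → E u v → ⊥
      -- A vertex `w` blocks `uv` and has one more neighbour `z`. The edge `wz` is in turn blocked
      -- by some `t`, a neighbour of `w`: `t ≡ z` would be a loop, and `t ≡ u` or `t ≡ v` yields
      -- twins.
      edge {u} {v} uv = unblocked uv λ w wu wv ¬two → dense (live wu) λ dw →
        let z , wz , z≢u , z≢v = one-other dw u v
            N-w = ¬two⇒N ¬two wz z≢u z≢v
        in unblocked wz λ t tw tz ¬two′ → blocked wu wv wz z≢u z≢v N-w tw tz ¬two′ (N-w t (E-sym tw))
        where
        blocked : ∀ {w z t} → E w u → E w v → E w z → z ≢ u → z ≢ v →
                  (∀ t → E w t → t ≡ u ⊎ t ≡ v ⊎ t ≡ z) → E t w → E t z → ¬ TwoBesides w z (E t) →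
                  t ≡ u ⊎ t ≡ v ⊎ t ≡ z → ⊥
        blocked wu wv wz z≢u z≢v N-w tw tz ¬two (inj₁ refl) =
          blocked-twice uv wu wv wz z≢v tz N-w ¬two
        blocked wu wv wz z≢u z≢v N-w tw tz ¬two (inj₂ (inj₁ refl)) =
          blocked-twice (E-sym uv) wv wu wz z≢u tz
            (λ t e → [ inj₂ ∘ inj₁ , [ inj₁ , inj₂ ∘ inj₂ ]′ ]′ (N-w t e)) ¬two
        blocked wu wv wz z≢u z≢v N-w tw tz ¬two (inj₂ (inj₂ refl)) = irr tz

  dense⇒minor : ∀ {E A} → Acc _<_ (length A) → Dense E A → ¬ ¬ Minor E
  dense⇒minor (acc rs) D free =
    Reduce.contradiction D free (λ lt → dense⇒minor (rs lt))

  low-degree-vertex : ∀ {E A} → IsGraph E A → ¬ Minor E → ∃[ x ] x ∈ A →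
                      ¬ ¬ (∃[ v ] v ∈ A × ¬ Three (E v))
  low-degree-vertex g free some ∄ = dense⇒minor (<-wellFounded _)
    (record { graph = g ; dense = λ x∈A ¬d → ∄ (_ , x∈A , ¬d) ; some = some }) free

  -- Deleting simplicial vertices of degree at most two.

  _∖_ : Rel V 0ℓ → V → Rel V 0ℓ
  (E ∖ v) x y = x ≢ v × y ≢ v × E x y

  -- Shaped to agree definitionally with the adjacency of `addEdge`.
  add : Rel V 0ℓ → V → V → Rel V 0ℓ
  add E u v x y = E x y ⊎ (x ≡ u × y ≡ v ⊎ x ≡ v × y ≡ u)

  record Simple (E : Rel V 0ℓ) : Set where
    constructor simple
    field
      E-sym : Symmetric E
      irr   : ∀ {x} → ¬ E x x

  ∖-simple : ∀ {E v} → Simple E → Simple (E ∖ v)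
  ∖-simple (simple E-sym irr) = simple (λ (p , q , e) → q , p , E-sym e) (λ (_ , _ , e) → irr e)

  add-simple : ∀ {E u v} → u ≢ v → Simple E → Simple (add E u v)
  add-simple u≢v (simple E-sym irr) = simple
    (Sum.map E-sym λ { (inj₁ (p , q)) → inj₂ (q , p) ; (inj₂ (p , q)) → inj₁ (q , p) })
    λ { (inj₁ e)                    → irr e
      ; (inj₂ (inj₁ (refl , refl))) → u≢v refl
      ; (inj₂ (inj₂ (refl , refl))) → u≢v refl }

  -- A path through `v` is shortcut by the edge between the neighbours it uses. An edge from `v` to
  -- another branch set is replaced by one from a neighbour of `v` in the branch set of `v`.
  remove-simplicial : ∀ {E v} → Simple E → ¬ Three (E v) →
                      (∀ {s t} → E v s → E v t → s ≢ t → E s t) → Minor E → ¬ ¬ Minor (E ∖ v)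
  remove-simplicial {E} {v} (simple E-sym irr) ¬three clique m k = remove (label v) refl
    where
    open Minor m

    -- v alone cannot be a branch set, since it has fewer than three neighbours.
    not-alone : ∀ {i} → label v ≡ just i → ¬ ¬ (∃[ s ] E v s × label s ≡ just i)
    not-alone {i} v∈i ∄ = ¬three (three
        (distinct λ ()) (distinct λ ()) (distinct λ ())
        (neighbour-adj zero) (neighbour-adj (suc zero)) (neighbour-adj (suc (suc zero))))
      where
      only : ∀ {x} → label x ≡ just i → v ≡ x
      only x∈i with conn v∈i x∈i
      ... | ε               = refl
      ... | (_ , q , e) ◅ _ = ⊥-elim (∄ (_ , e , q))

      -- `punchIn i` enumerates the three labels other than `i`; with `v` alone in its branch set,
      -- each of those sets contains a neighbour of `v`.
      joined : ∀ j → ∃[ y ] E v y × label y ≡ just (punchIn i j)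
      joined j with join (≢-sym (Fin.punchInᵢ≢i i j))
      ... | x , y , p , q , e with only p
      ...   | refl = y , e , q

      neighbour : Fin 3 → V
      neighbour j = proj₁ (joined j)

      neighbour-adj : ∀ j → E v (neighbour j)
      neighbour-adj j = proj₁ (proj₂ (joined j))

      distinct : ∀ {j k} → j ≢ k → neighbour j ≢ neighbour k
      distinct {j} {k} j≢k eq = j≢k (Fin.punchIn-injective i j k (Maybe.just-injective
        (trans (sym (proj₂ (proj₂ (joined j)))) (trans (cong label eq) (proj₂ (proj₂ (joined k)))))))

    label′ : V → Maybe (Fin 4)
    label′ t = if does (t ≟ v) then nothing else label t

    label′⁺ : ∀ {t j} → t ≢ v → label t ≡ just j → label′ t ≡ just j
    label′⁺ {t} t≢v p rewrite dec-false (t ≟ v) t≢v = p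

    label′⁻ : ∀ {t j} → label′ t ≡ just j → t ≢ v × label t ≡ just j
    label′⁻ {t} p with t ≟ v
    label′⁻ {t} () | yes _
    ... | no t≢v = t≢v , p

    neighbour≢v : ∀ {s} → E v s → s ≢ v
    neighbour≢v vs refl = irr vs

    bypass : ∀ {j x y} → x ≢ v → y ≢ v → Star (Within E (λ t → label t ≡ just j)) x y →
             Star (Within (E ∖ v) (λ t → label′ t ≡ just j)) x y
    bypass x≢v y≢v ε = ε
    bypass x≢v y≢v (_◅_ {j = z} (p , q , e) path) with z ≟ v
    ... | no z≢v = (label′⁺ x≢v p , label′⁺ z≢v q , x≢v , z≢v , e) ◅ bypass z≢v y≢v path
    bypass x≢v y≢v (_ ◅ ε) | yes refl = ⊥-elim (y≢v refl)
    bypass {x = x} x≢v y≢v ((p , _ , e) ◅ (_◅_ {j = w} (_ , q , e′) path)) | yes refl with x ≟ w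
    ... | yes refl = bypass x≢v y≢v path
    ... | no x≢w   = (label′⁺ x≢v p , label′⁺ w≢v q , x≢v , w≢v , clique (E-sym e) e′ x≢w)
                     ◅ bypass w≢v y≢v path
      where w≢v = neighbour≢v e′

    different : ∀ {i j x y} → i ≢ j → label x ≡ just i → label y ≡ just j → x ≢ y
    different i≢j p q refl = i≢j (Maybe.just-injective (trans (sym p) q))

    rejoin : (∀ {i} → label v ≡ just i → ∃[ s ] E v s × label s ≡ just i) →
             ∀ {i j} → i ≢ j → ∃[ x ] ∃[ y ] label′ x ≡ just i × label′ y ≡ just j × (E ∖ v) x y
    rejoin mate i≢j with join i≢j
    ... | x , y , p , q , e with x ≟ v | y ≟ v
    ...   | yes refl | yes refl = ⊥-elim (irr e)
    ...   | no x≢v   | no y≢v   = x , y , label′⁺ x≢v p , label′⁺ y≢v q , x≢v , y≢v , e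
    ...   | yes refl | no y≢v   =
      let s , vs , r = mate p
          s≢v = neighbour≢v vs
      in s , y , label′⁺ s≢v r , label′⁺ y≢v q , s≢v , y≢v , clique vs e (different i≢j r q)
    ...   | no x≢v   | yes refl =
      let s , vs , r = mate q
          s≢v = neighbour≢v vs
      in x , s , label′⁺ x≢v p , label′⁺ s≢v r , x≢v , s≢v , clique (E-sym e) vs (different i≢j p r)

    finish : (∀ {i} → label v ≡ just i → ∃[ s ] E v s × label s ≡ just i) → ⊥
    finish mate = k record
      { label = label′
      ; conn  = λ p q → let x≢v , p′ = label′⁻ p ; y≢v , q′ = label′⁻ q in
                        bypass x≢v y≢v (conn p′ q′)
      ; join  = rejoin mate
      }

    remove : ∀ l → label v ≡ l → ⊥
    -- An unlabelled `v` needs no replacement, so the `mate` condition is vacuous.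
    remove nothing  eq = finish λ p → ⊥-elim (nothing≢just (trans (sym eq) p))
      where
      nothing≢just : ∀ {i : Fin 4} → nothing ≢ just i
      nothing≢just ()
    remove (just i) eq = not-alone eq λ (s , vs , r) →
      finish λ p → s , vs , trans r (trans (sym eq) p)

  -- The option `p ≡ q` covers degree at most one; otherwise the two possible neighbours are
  -- adjacent. Either way the neighbours form a clique.
  remove-ear : ∀ {E v} → Simple E → ∀ p q → (∀ t → E v t → t ≡ p ⊎ t ≡ q) → p ≡ q ⊎ E p q →
               Minor E → ¬ ¬ Minor (E ∖ v)
  remove-ear {E} {v} S p q N-v pq = remove-simplicial S
    (λ d → let z , vz , z≢p , z≢q = one-other d p q in [ z≢p , z≢q ]′ (N-v z vz))
    (λ {s} {t} vs vt → clique (N-v s vs) (N-v t vt) pq)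
    where
    clique : ∀ {s t} → s ≡ p ⊎ s ≡ q → t ≡ p ⊎ t ≡ q → p ≡ q ⊎ E p q → s ≢ t → E s t
    clique (inj₁ refl) (inj₁ refl) _           s≢t = ⊥-elim (s≢t refl)
    clique (inj₂ refl) (inj₂ refl) _           s≢t = ⊥-elim (s≢t refl)
    clique (inj₁ refl) (inj₂ refl) (inj₁ refl) s≢t = ⊥-elim (s≢t refl)
    clique (inj₁ refl) (inj₂ refl) (inj₂ e)    _   = e
    clique (inj₂ refl) (inj₁ refl) (inj₁ refl) s≢t = ⊥-elim (s≢t refl)
    clique (inj₂ refl) (inj₁ refl) (inj₂ e)    _   = Simple.E-sym S e

  -- Edge-maximal K₄-minor-free graphs and the target colouring.

  record Maximal (E : Rel V 0ℓ) (A : List V) : Set where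
    field
      graph    : IsGraph E A
      free     : ¬ Minor E
      saturate : ∀ {u v} → u ∈ A → v ∈ A → u ≢ v → ¬ E u v → ¬ ¬ Minor (add E u v)

    open IsGraph graph public

    E-simple : Simple E
    E-simple = simple E-sym irr

  Proper : Rel V 0ℓ → (V → Fin 3) → Set
  Proper E c = ∀ {x y} → E x y → c x ≢ c y

  InTriangle : Rel V 0ℓ → V → Set
  InTriangle E x = ∃[ a ] ∃[ b ] E x a × E x b × E a b

  third-colour : (i j : Fin 3) → ∃[ k ] k ≢ i × k ≢ j
  third-colour zero             zero             = suc zero , (λ ()) , (λ ())
  third-colour zero             (suc zero)       = suc (suc zero) , (λ ()) , (λ ())
  third-colour zero             (suc (suc zero)) = suc zero , (λ ()) , (λ ())
  third-colour (suc zero)       zero             = suc (suc zero) , (λ ()) , (λ ())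
  third-colour (suc zero)       (suc j)          = zero , (λ ()) , (λ ())
  third-colour (suc (suc zero)) zero             = suc zero , (λ ()) , (λ ())
  third-colour (suc (suc zero)) (suc j)          = zero , (λ ()) , (λ ())

  extend-colouring : ∀ {E v a b c} → Simple E → (∀ t → E v t → t ≡ a ⊎ t ≡ b) →
                     Proper (E ∖ v) c → ∃ (Proper E)
  extend-colouring {E} {v} {a} {b} {c} (simple E-sym irr) N-v proper = c′ , proper′
    where
    new = third-colour (c a) (c b)

    c′ : V → Fin 3
    c′ x = if does (x ≟ v) then proj₁ new else c x

    new≢ : ∀ {t} → E v t → proj₁ new ≢ c t
    new≢ {t} vt with N-v t vt
    ... | inj₁ refl = proj₁ (proj₂ new)
    ... | inj₂ refl = proj₂ (proj₂ new)

    proper′ : Proper E c′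
    proper′ {x} {y} e with x ≟ v | y ≟ v
    ... | yes refl | yes refl = ⊥-elim (irr e)
    ... | yes refl | no _     = new≢ e
    ... | no _     | yes refl = ≢-sym (new≢ (E-sym e))
    ... | no x≢v   | no y≢v   = proper (x≢v , y≢v , e)

  Coloured : Rel V 0ℓ → List V → Set
  Coloured E A = ∃ (Proper E) × (∀ {x} → x ∈ A → InTriangle E x)

  without : V → List V → List V
  without v = filter (λ t → ¬? (t ≟ v))

  -- Peeling off a vertex of degree at most two.

  module Peel {E : Rel V 0ℓ} {A : List V} (M : Maximal E A) (size : Three (_∈ A))
              {v : V} (v∈A : v ∈ A) (low : ¬ Three (E v)) where
    open Maximal M

    -- After adding `vb` the vertex `v` is still simplicial, so the minor forced by saturation
    -- survives the deletion of `v`, and the new edge goes with it. What is left lies in `E`.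
    no-ear : ∀ {a b} → b ∈ A → v ≢ b → ¬ E v b → (∀ t → E v t → t ≡ a) → a ≡ b ⊎ E a b → ⊥
    no-ear {a} {b} b∈A v≢b ¬vb N-v ab = saturate v∈A b∈A v≢b ¬vb λ m →
      remove-ear (add-simple v≢b E-simple) a b
        (λ { t (inj₁ e)                → inj₁ (N-v t e)
           ; t (inj₂ (inj₁ (_ , p)))   → inj₂ p
           ; t (inj₂ (inj₂ (v≡b , _))) → ⊥-elim (v≢b v≡b) })
        (Sum.map₂ inj₁ ab) m
        (free ∘ minor-mono λ { (_   , _   , inj₁ e)                 → e
                             ; (x≢v , _   , inj₂ (inj₁ (x≡v , _))) → ⊥-elim (x≢v x≡v)
                             ; (_   , y≢v , inj₂ (inj₂ (_ , y≡v))) → ⊥-elim (y≢v y≡v) })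

    not-isolated : ¬ ¬ (∃[ a ] E v a)
    not-isolated ∄ =
      let u , u∈A , u≢v , _ = one-other size v v
      -- For an isolated `v`, any other vertex `u` serves as both `a` and `b`.
      in no-ear {u} u∈A (≢-sym u≢v) (λ e → ∄ (_ , e)) (λ t e → ⊥-elim (∄ (t , e))) (inj₁ refl)

    -- Add an edge from `v` to a third vertex `b`. Then `a` hangs on `v`, and once `a` is deleted
    -- `v` hangs on `b`; deleting both leaves the minor inside `E`.
    no-isolated-edge : ∀ {a} → E v a → (∀ t → E v t → t ≡ a) → (∀ t → E a t → t ≡ v) → ⊥
    no-isolated-edge {a} va N-v N-a with one-other size v a
    ... | b , b∈A , b≢v , b≢a = saturate v∈A b∈A v≢b (b≢a ∘ N-v b) λ m →
      remove-ear S v v N-a′ (inj₁ refl) m λ m′ →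
      remove-ear (∖-simple S) b b N-v′ (inj₁ refl) m′ (free ∘ minor-mono back)
      where
      v≢b = ≢-sym b≢v
      S = add-simple v≢b E-simple

      N-a′ : ∀ t → add E v b a t → t ≡ v ⊎ t ≡ v
      N-a′ t (inj₁ e)                = inj₁ (N-a t e)
      N-a′ t (inj₂ (inj₁ (a≡v , _))) = ⊥-elim (adj⇒≢ va (sym a≡v))
      N-a′ t (inj₂ (inj₂ (a≡b , _))) = ⊥-elim (b≢a (sym a≡b))

      N-v′ : ∀ t → (add E v b ∖ a) v t → t ≡ b ⊎ t ≡ b
      N-v′ t (_ , t≢a , inj₁ e)                = ⊥-elim (t≢a (N-v t e))
      N-v′ t (_ , _   , inj₂ (inj₁ (_ , t≡b))) = inj₁ t≡b
      N-v′ t (_ , _   , inj₂ (inj₂ (v≡b , _))) = ⊥-elim (v≢b v≡b)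

      back : ∀ {x y} → ((add E v b ∖ a) ∖ v) x y → E x y
      back (_   , _   , _ , _ , inj₁ e)                = e
      back (x≢v , _   , _ , _ , inj₂ (inj₁ (x≡v , _))) = ⊥-elim (x≢v x≡v)
      back (_   , y≢v , _ , _ , inj₂ (inj₂ (_ , y≡v))) = ⊥-elim (y≢v y≡v)

    not-leaf : ∀ {a} → E v a → ¬ ¬ (∃[ b ] E v b × b ≢ a)
    not-leaf {a} va ∄ = cases
      (λ ((b , ab , b≢v) : ∃[ b ] E a b × b ≢ v) →
        no-ear (live′ ab) (≢-sym b≢v) (λ vb → adj⇒≢ ab (sym (N-v b vb))) N-v (inj₂ ab))
      (λ ∄′ → no-isolated-edge va N-v λ t at → decidable-stable (t ≟ v) λ t≢v → ∄′ (t , at , t≢v))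
      where
      N-v : ∀ t → E v t → t ≡ a
      N-v t vt = decidable-stable (t ≟ a) λ t≢a → ∄ (t , vt , t≢a)

    N-v : ∀ {a b} → E v a → E v b → b ≢ a → ∀ t → E v t → t ≡ a ⊎ t ≡ b
    N-v {a} {b} va vb b≢a t vt with t ≟ a | t ≟ b
    ... | yes p  | _      = inj₁ p
    ... | no _   | yes p  = inj₂ p
    ... | no t≢a | no t≢b = ⊥-elim (low (three (≢-sym b≢a) (≢-sym t≢a) (≢-sym t≢b) va vb vt))

    -- If `ab` is missing, adding it makes `v` simplicial, so the forced minor avoids `v`. But
    -- contracting `v` into `a` turns `vb` into `ab`, so `E` already has that minor.
    neighbours-adjacent : ∀ {a b} → E v a → E v b → b ≢ a → ¬ ¬ E a b
    neighbours-adjacent {a} {b} va vb b≢a ¬ab =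
      saturate (live′ va) (live′ vb) (≢-sym b≢a) ¬ab λ m →
      remove-ear (add-simple (≢-sym b≢a) E-simple) a b N-v′ (inj₂ (inj₂ (inj₁ (refl , refl)))) m
        (free ∘ minor-pullback φ E-sym (idem a≢v) (near E λ { _ refl → va }) ∘ minor-mono into)
      where
      open Collapse (_≟ v) a
      a≢v = ≢-sym (adj⇒≢ va)
      b≢v = ≢-sym (adj⇒≢ vb)

      N-v′ : ∀ t → add E a b v t → t ≡ a ⊎ t ≡ b
      N-v′ t (inj₁ e)                = N-v va vb b≢a t e
      N-v′ t (inj₂ (inj₁ (v≡a , _))) = ⊥-elim (adj⇒≢ va v≡a)
      N-v′ t (inj₂ (inj₂ (v≡b , _))) = ⊥-elim (adj⇒≢ vb v≡b)

      into : ∀ {x y} → (add E a b ∖ v) x y → (E /φ φ) x y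
      into (x≢v , y≢v , inj₁ e) = adj⇒≢ e , _ , _ , outside x≢v , outside y≢v , e
      into (_ , _ , inj₂ (inj₁ (refl , refl))) =
        ≢-sym b≢a , v , b , inside refl , outside b≢v , vb
      into (_ , _ , inj₂ (inj₂ (refl , refl))) =
        b≢a , b , v , outside b≢v , inside refl , E-sym vb

    without-graph : IsGraph (E ∖ v) (without v A)
    without-graph = record
      { E-sym = Simple.E-sym (∖-simple E-simple)
      ; irr   = Simple.irr (∖-simple E-simple)
      ; live  = λ (x≢v , _ , e) → ∈-filter⁺ _ (live e) x≢v
      }

    -- An edge `xy` added away from `v` leaves `v` with the same two adjacent neighbours, so the
    -- minor it creates survives the deletion of `v`.
    without-maximal : ∀ {a b} → E v a → E v b → b ≢ a → E a b → Maximal (E ∖ v) (without v A)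
    without-maximal {a} {b} va vb b≢a ab = record
      { graph    = without-graph
      ; free     = free ∘ minor-mono λ (_ , _ , e) → e
      ; saturate = λ x∈ y∈ x≢y ¬xy k →
          let x∈A , x≢v = ∈-filter⁻ _ x∈ ; y∈A , y≢v = ∈-filter⁻ _ y∈ in
          saturate x∈A y∈A x≢y (λ e → ¬xy (x≢v , y≢v , e)) λ m →
          remove-ear (add-simple x≢y E-simple) a b
            (λ { t (inj₁ e)                → N-v va vb b≢a t e
               ; t (inj₂ (inj₁ (v≡x , _))) → ⊥-elim (x≢v (sym v≡x))
               ; t (inj₂ (inj₂ (v≡y , _))) → ⊥-elim (y≢v (sym v≡y)) })
            (inj₂ (inj₁ ab)) m
            (k ∘ minor-mono λ (p , q , e) → Sum.map₁ (λ e → p , q , e) e)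
      }

    -- The triangle `v`, `a`, `b` serves its own vertices. Exempting `a` and `b` from the hypothesis
    -- lets `base` use the lemma when only one edge remains.
    extend : ∀ {a b} → E v a → E v b → b ≢ a → E a b → ∃ (Proper (E ∖ v)) →
             (∀ {x} → x ∈ without v A → x ≢ a → x ≢ b → InTriangle (E ∖ v) x) → Coloured E A
    extend {a} {b} va vb b≢a ab (c , proper) triangle =
      extend-colouring E-simple (N-v va vb b≢a) proper , triangle′
      where
      triangle′ : ∀ {x} → x ∈ A → InTriangle E x
      triangle′ {x} x∈A with x ≟ v | x ≟ a | x ≟ b
      ... | yes refl | _        | _        = a , b , va , vb , ab
      ... | no _     | yes refl | _        = v , b , E-sym va , ab , vb
      ... | no _     | no _     | yes refl = v , a , E-sym vb , E-sym ab , va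
      ... | no x≢v   | no x≢a   | no x≢b   =
        let s , t , (_ , _ , xs) , (_ , _ , xt) , (_ , _ , st) =
              triangle (∈-filter⁺ _ x∈A x≢v) x≢a x≢b
        in s , t , xs , xt , st

    -- Once only a and b are left, colouring a differently from everything else is proper.
    base : ∀ {a b} → E v a → E v b → b ≢ a → E a b → ¬ Three (_∈ without v A) → Coloured E A
    base {a} {b} va vb b≢a ab small =
      extend va vb b≢a ab (c , proper) λ x∈ x≢a x≢b → ⊥-elim (only x∈ x≢a x≢b)
      where
      a∈ = ∈-filter⁺ _ (live′ va) (≢-sym (adj⇒≢ va))
      b∈ = ∈-filter⁺ _ (live′ vb) (≢-sym (adj⇒≢ vb))

      only : ∀ {x} → x ∈ without v A → x ≢ a → x ≢ b → ⊥
      only x∈ x≢a x≢b = small (three (≢-sym b≢a) (≢-sym x≢a) (≢-sym x≢b) a∈ b∈ x∈)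

      c : V → Fin 3
      c x = if does (x ≟ a) then zero else suc zero

      proper : Proper (E ∖ v) c
      proper {x} {y} (x≢v , y≢v , e) with x ≟ a | y ≟ a
      ... | yes refl | yes refl = ⊥-elim (irr e)
      ... | yes _    | no _     = λ ()
      ... | no _     | yes _    = λ ()
      ... | no x≢a   | no y≢a   with x ≟ b | y ≟ b
      ...   | yes refl | yes refl = ⊥-elim (irr e)
      ...   | no x≢b   | _        = ⊥-elim (only (∈-filter⁺ _ (live e) x≢v) x≢a x≢b)
      ...   | yes _    | no y≢b   = ⊥-elim (only (∈-filter⁺ _ (live′ e) y≢v) y≢a y≢b)

  -- The induction runs only while three vertices remain after peeling: a single edge has no
  -- triangle, so the last step goes to `base`.
  maximal⇒coloured : ∀ {E A} → Acc _<_ (length A) → Maximal E A → Three (_∈ A) → ¬ ¬ Coloured E A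
  maximal⇒coloured {E} {A} (acc rs) M size k =
    low-degree-vertex graph free (_ , Three.Pa size) λ (v , v∈A , low) →
    let open Peel M size v∈A low in
    not-isolated λ (a , va) → not-leaf va λ (b , vb , b≢a) → neighbours-adjacent va vb b≢a λ ab →
    cases
      (λ (size′ : Three (_∈ without v A)) →
        maximal⇒coloured
          (rs (filter-notAll (λ t → ¬? (t ≟ v)) A (lose v∈A λ v≢v → v≢v refl)))
          (without-maximal va vb b≢a ab) size′
          λ (colouring , triangle) → k (extend va vb b≢a ab colouring λ x∈ _ _ → triangle x∈))
      (λ small → k (base va vb b≢a ab small))
    where open Maximal M

open Minors using (Minor; Maximal; three; maximal⇒coloured)

-- Translation between labellings and branch sets on `Fin n`.

select : ∀ {n} {P : Pred (Fin n) 0ℓ} → Decidable P → Subset n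
select P? = tabulate (λ x → does (P? x))

select⁺ : ∀ {n} {P : Pred (Fin n) 0ℓ} (P? : Decidable P) {x} → P x → x Subset.∈ select P?
select⁺ P? {x} p = lookup⇒[]= x _ (trans (lookup∘tabulate _ x) (dec-true (P? x) p))

select⁻ : ∀ {n} {P : Pred (Fin n) 0ℓ} (P? : Decidable P) {x} → x Subset.∈ select P? → P x
select⁻ P? {x} x∈ with P? x | trans (sym (lookup∘tabulate (λ x → does (P? x)) x)) ([]=⇒lookup x∈)
... | yes p | _ = p
... | no _  | ()

minor⇒isMinor : ∀ {n} {G : Graph n} → Minor Fin._≟_ (Adj G) → K 4 IsMinorOf G
minor⇒isMinor m = record
  { branch    = λ i → select (in? i)
  -- Nonemptiness comes from the edge joining branch set `i` to some other one, here
  -- `punchIn i zero`.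
  ; connected = λ i → (let x , _ , p , _ = join (≢-sym (Fin.punchInᵢ≢i i zero)) in x , select⁺ (in? i) p)
                    , λ x∈ y∈ → Star.map (λ (p , q , e) → select⁺ (in? i) p , select⁺ (in? i) q , e)
                                  (conn (select⁻ (in? i) x∈) (select⁻ (in? i) y∈))
  ; disjoint  = λ {i} {j} i≢j (x , x∈) → let p , q = Subset.x∈p∩q⁻ _ _ x∈ in
                  i≢j (Maybe.just-injective (trans (sym (select⁻ (in? i) p)) (select⁻ (in? j) q)))
  ; joined    = λ {i} {j} i≢j → let x , y , p , q , e = join i≢j in
                  x , y , select⁺ (in? i) p , select⁺ (in? j) q , e
  }
  where
  open Minor m
  in? : ∀ i → Decidable (λ x → label x ≡ just i)
  in? i x = Maybe.≡-dec Fin._≟_ (label x) (just i)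

isMinor⇒minor : ∀ {n} {G : Graph n} → K 4 IsMinorOf G → Minor Fin._≟_ (Adj G)
isMinor⇒minor {n} m = record
  { label = label
  ; conn  = λ {i} p q → Star.map (λ (p , q , e) → label⁺ p , label⁺ q , e)
                          (proj₂ (connected i) (label⁻ p) (label⁻ q))
  ; join  = λ i≢j → let x , y , p , q , e = joined i≢j in x , y , label⁺ p , label⁺ q , e
  }
  where
  open _IsMinorOf_ m
  label : Fin n → Maybe (Fin 4)
  label x with Fin.any? (λ i → x Subset.∈? branch i)
  ... | yes (i , _) = just i
  ... | no _        = nothing

  label⁻ : ∀ {x i} → label x ≡ just i → x Subset.∈ branch i
  label⁻ {x} eq with Fin.any? (λ i → x Subset.∈? branch i)
  label⁻ refl | yes (_ , x∈) = x∈

  label⁺ : ∀ {x i} → x Subset.∈ branch i → label x ≡ just i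
  label⁺ {x} {i} x∈ with Fin.any? (λ i → x Subset.∈? branch i)
  ... | no ∄ = ⊥-elim (∄ (i , x∈))
  ... | yes (j , x∈′) with i Fin.≟ j
  ...   | yes refl = refl
  ...   | no i≢j   = ⊥-elim (disjoint i≢j (x , Subset.x∈p∩q⁺ (x∈ , x∈′)))

maximal : ∀ {n} {G : Graph n} → MaximalK₄MinorFree G → Maximal Fin._≟_ (Adj G) (allFin n)
maximal {n} {G} (free , saturate) = record
  { graph    = record { E-sym = symm G ; irr = irrefl G refl ; live = λ _ → ∈-allFin _ }
  ; free     = free ∘ minor⇒isMinor
  ; saturate = λ _ _ u≢v ¬uv k → saturate _ _ u≢v ¬uv (k ∘ isMinor⇒minor)
  }

-- Sizes of unions of two colour classes.

avoiding : ∀ {n} → (Fin n → Fin 3) → Fin 3 → Subset n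
avoiding c i = select (λ x → ¬? (c x Fin.≟ i))

-- Every vertex avoids exactly two of the three colours.
∣avoiding∣-sum : ∀ {n} (c : Fin n → Fin 3) →
  ∣ avoiding c zero ∣ + ∣ avoiding c (suc zero) ∣ + ∣ avoiding c (suc (suc zero)) ∣ ≡ 2 * n
∣avoiding∣-sum {ℕ.zero}  c = refl
∣avoiding∣-sum {ℕ.suc n} c with c zero | ∣avoiding∣-sum (c ∘ suc)
-- The colour of the first vertex decides which two of the three sets gain an element.
... | zero | ih =
  trans (shift (size zero) (size (suc zero)) (size (suc (suc zero)))) (trans (cong (2 +_) ih) (sym (ℕ.*-suc 2 n)))
  where
  size = λ i → ∣ avoiding (c ∘ suc) i ∣
  shift : ∀ p q r → p + ℕ.suc q + ℕ.suc r ≡ 2 + (p + q + r)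
  shift = solve 3 (λ p q r → p :+ (con 1 :+ q) :+ (con 1 :+ r) := con 2 :+ (p :+ q :+ r)) refl
    where open +-*-Solver
... | suc zero | ih =
  trans (shift (size zero) (size (suc zero)) (size (suc (suc zero)))) (trans (cong (2 +_) ih) (sym (ℕ.*-suc 2 n)))
  where
  size = λ i → ∣ avoiding (c ∘ suc) i ∣
  shift : ∀ p q r → ℕ.suc p + q + ℕ.suc r ≡ 2 + (p + q + r)
  shift = solve 3 (λ p q r → (con 1 :+ p) :+ q :+ (con 1 :+ r) := con 2 :+ (p :+ q :+ r)) refl
    where open +-*-Solver
... | suc (suc zero) | ih =
  trans (shift (size zero) (size (suc zero)) (size (suc (suc zero)))) (trans (cong (2 +_) ih) (sym (ℕ.*-suc 2 n)))
  where
  size = λ i → ∣ avoiding (c ∘ suc) i ∣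
  shift : ∀ p q r → ℕ.suc p + ℕ.suc q + r ≡ 2 + (p + q + r)
  shift = solve 3 (λ p q r → (con 1 :+ p) :+ (con 1 :+ q) :+ r := con 2 :+ (p :+ q :+ r)) refl
    where open +-*-Solver

-- With `q` the floor of `2n/3`, three sets of size at least `q + 1` would sum to `3q + 3`, which
-- exceeds `2n`.
small-avoiding : ∀ {n} (c : Fin n → Fin 3) → ∃[ i ] ∣ avoiding c i ∣ ≤ (2 * n) / 3
small-avoiding {n} c with Fin.any? (λ i → ∣ avoiding c i ∣ ℕ.≤? (2 * n) / 3)
... | yes found = found
... | no none   = ⊥-elim (ℕ.<-irrefl refl (begin-strict
    2 * n                                    ≡⟨ ℕ.m≡m%n+[m/n]*n (2 * n) 3 ⟩
    (2 * n) ℕ.% 3 + (2 * n) / 3 * 3          <⟨ ℕ.+-monoˡ-< _ (ℕ.m%n<n (2 * n) 3) ⟩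
    3 + q * 3                                ≡⟨ triple q ⟩
    ℕ.suc q + ℕ.suc q + ℕ.suc q              ≤⟨ ℕ.+-mono-≤ (ℕ.+-mono-≤ (large _) (large _)) (large _) ⟩
    _                                        ≡⟨ ∣avoiding∣-sum c ⟩
    2 * n                                    ∎))
  where
  open ℕ.≤-Reasoning
  q = (2 * n) / 3
  large : ∀ i → q < ∣ avoiding c i ∣
  large i = ℕ.≰⇒> λ le → none (i , le)

  triple : ∀ q → 3 + q * 3 ≡ ℕ.suc q + ℕ.suc q + ℕ.suc q
  triple = solve 1 (λ q → con 3 :+ q :* con 3 := (con 1 :+ q) :+ (con 1 :+ q) :+ (con 1 :+ q)) refl
    where open +-*-Solver

-- From the colouring to double domination.

two-members : ∀ {n} {p : Subset n} {x y} → x ≢ y → x Subset.∈ p → y Subset.∈ p → 2 ≤ ∣ p ∣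
two-members x≢y x∈ y∈ = ℕ.≤-trans (s≤s (ℕ.≤-trans (s≤s z≤n)
  (Subset.x∈p⇒∣p-x∣<∣p∣ (Subset.x∈p∧x≢y⇒x∈p-y y∈ (≢-sym x≢y))))) (Subset.x∈p⇒∣p-x∣<∣p∣ x∈)

avoiding-dominates : ∀ {n} (G : Graph n) (c : Fin n → Fin 3) → (∀ {x y} → Adj G x y → c x ≢ c y) →
  (∀ v → ∃[ a ] ∃[ b ] Adj G v a × Adj G v b × Adj G a b) → ∀ i → DoubleDominating G (avoiding c i)
avoiding-dominates G c proper triangle i v with triangle v
... | a , b , va , vb , ab = dominated
  where
  member : ∀ {x} → x Subset.∈ N[ G , v ] → c x ≢ i → x Subset.∈ N[ G , v ] ∩ avoiding c i
  member x∈ cx≢i = Subset.x∈p∩q⁺ (x∈ , select⁺ (λ x → ¬? (c x Fin.≟ i)) cx≢i)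

  self : v Subset.∈ N[ G , v ]
  self = Subset.x∈p∪q⁺ (inj₁ (Subset.x∈⁅x⁆ v))

  neighbour : ∀ {x} → Adj G v x → x Subset.∈ N[ G , v ]
  neighbour vx = Subset.x∈p∪q⁺ (inj₂ (select⁺ (adj? G v) vx))

  adj⇒≢ : ∀ {x y} → Adj G x y → x ≢ y
  adj⇒≢ e x≡y = irrefl G x≡y e

  dominated : 2 ≤ ∣ N[ G , v ] ∩ avoiding c i ∣
  -- At most one vertex of the triangle has colour `i`; the other two are the required members.
  dominated with c v Fin.≟ i | c a Fin.≟ i
  ... | yes refl | _        = two-members (adj⇒≢ ab) (member (neighbour va) (≢-sym (proper va)))
                                (member (neighbour vb) (≢-sym (proper vb)))
  ... | no cv≢i  | yes refl = two-members (adj⇒≢ vb) (member self cv≢i)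
                                (member (neighbour vb) (≢-sym (proper ab)))
  ... | no cv≢i  | no ca≢i  = two-members (adj⇒≢ va) (member self cv≢i) (member (neighbour va) ca≢i)

doubleDominating? : ∀ {n} (G : Graph n) → Decidable (DoubleDominating G)
doubleDominating? G S = Fin.all? λ v → 2 ℕ.≤? ∣ N[ G , v ] ∩ S ∣

-- Descent: pass to a strictly smaller double dominating set until there is none; the last one
-- attains the minimum.
γ×2-exists : ∀ {n} (G : Graph n) S → Acc _<_ ∣ S ∣ → DoubleDominating G S →
             ∃[ k ] (γ×2[ G ]≡ k) × k ≤ ∣ S ∣
γ×2-exists G S (acc rs) dom with Subset.anySubset? (λ T → doubleDominating? G T ×-dec (∣ T ∣ ℕ.<? ∣ S ∣))
... | yes (T , dom′ , T<S) = let k , γ , k≤ = γ×2-exists G T (rs T<S) dom′ in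
                             k , γ , ℕ.≤-trans k≤ (ℕ.<⇒≤ T<S)
... | no ∄ = ∣ S ∣ , ((S , dom , refl) , λ T dom′ → ℕ.≮⇒≥ λ T<S → ∄ (T , dom′ , T<S)) , ℕ.≤-refl

small-dominating : ∀ n → 3 ≤ n → (G : Graph n) → MaximalK₄MinorFree G →
                   ∃[ S ] DoubleDominating G S × ∣ S ∣ ≤ (2 * n) / 3
-- Searching the finitely many subsets decides existence, which discharges the double negation
-- around the colouring.
small-dominating n (s≤s (s≤s (s≤s z≤n))) G M = decidable-stable
  (Subset.anySubset? λ S → doubleDominating? G S ×-dec (∣ S ∣ ℕ.≤? (2 * n) / 3))
  λ k → maximal⇒coloured Fin._≟_ (<-wellFounded _) (maximal {G = G} M)
    (three {a = zero} {suc zero} {suc (suc zero)} (λ ()) (λ ()) (λ ()) (∈-allFin _) (∈-allFin _) (∈-allFin _))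
    λ ((c , proper) , triangle) → let i , small = small-avoiding c in
      k (avoiding c i , avoiding-dominates G c proper (λ v → triangle (∈-allFin v)) i , small)

theorem3p2 : ∀ (n : ℕ) → 3 ≤ n → (G : Graph n) → MaximalK₄MinorFree G →
    ∃[ k ] (γ×2[ G ]≡ k) × k ≤ (2 * n) / 3
theorem3p2 n 3≤n G M =
  let S , dom , S≤ = small-dominating n 3≤n G M
      k , γ , k≤   = γ×2-exists G S (<-wellFounded _) dom
  in k , γ , ℕ.≤-trans k≤ S≤
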